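{- Assume an EC-derivation $\pi$ from $\psi=\phi\wedge\tilde l_1\wedge\dots\wedge\tilde l_k$, where $\phi$ is a conjunction of xor-clauses in 3-xor normal form and $\tilde l_1,\dots,\tilde l_k$ are xor-assumption literals. There is an extension $\pi'$ of $\pi$ where an xor-clause $(y\equiv p\oplus p_1'\oplus\dots\oplus p_{n-1}')$ is derived using the rule $\oplus$-Imply on the xor-clauses $\{(x_1\oplus x_2\equiv p_1\oplus p_1'),\ \dots,\ (x_{n-1}\oplus x_n\equiv p_{n-1}\oplus p_{n-1}'),\ (x_1\oplus x_n\oplus y\equiv p_n)\}$ if and only if there is an xor-cycle $\mathrm{XC}(\langle x_1,\dots,x_n\rangle,\langle y_1,\dots,y_{n-1},y\rangle,p)\subseteq\phi$, where $p=p_1\oplus\dots\oplus p_n$, such that for each $y_i\in\{y_1,\dots,y_{n-1}\}$ it holds that $\psi\vdash_{\mathrm{ec}}(y_i\equiv p_i')$.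
   Context: **Xor-clauses.** An xor-clause is written as an equation $z_1\oplus\dots\oplus z_k\equiv q$ over propositional variables with $q\in\{\bot,\top\}$ ($\oplus$ is exclusive or, $\bot$ is false, $\top$ is true); it is implicitly assumed to be in normal form, so that each variable occurs at most once in it. The literal $x$ is identified with $(x\equiv\top)$ and $\neg x$ with $(x\equiv\bot)$; $\bot$ as a clause denotes the empty, unsatisfiable xor-clause. Xor-assumption literals are literals $x$ or $\neg x$ with $x$ a variable of $\phi$. The symbols $x_i,y_i,y$ denote variables and $p,p_i,p_i'$ denote constants in $\{\bot,\top\}$. **3-xor normal form.** A conjunction of xor-clauses is in 3-xor normal form if (i) every xor-clause in it has exactly three variables, and (ii) each pair of xor-clauses in it shares at most one variable. **The system EC.** Its inference rules, written in equation form, are as follows ($x,y,z,x_i$ are variables and $a,b,c_i,d$ are constants in $\{\bot,\top\}$): - Conflict: from $(x\equiv\top)$ and $(x\equiv\bot)$ infer $\bot$. - $\oplus$-Unit$^2$: from $(x\equiv a)$ and $(x\oplus y\equiv b)$ infer $(y\equiv a\oplus b)$. - $\oplus$-Unit$^3$: from $(x\equiv a)$ and $(x\oplus y\oplus z\equiv b)$ infer $(y\oplus z\equiv a\oplus b)$. - $\oplus$-Imply: from $(x_1\oplus x_2\equiv c_1),\dots,(x_{n-1}\oplus x_n\equiv c_{n-1})$ and $(x_1\oplus x_n\oplus y\equiv d)$ infer $(y\equiv c_1\oplus\dots\oplus c_{n-1}\oplus d)$. - $\oplus$-Conflict: from $(x_1\oplus x_2\equiv c_1),\dots,(x_{n-1}\oplus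 x_n\equiv c_{n-1})$ and $(x_n\oplus x_1\equiv c_n)$ infer $\bot$, provided that $c_1\oplus\dots\oplus c_n=\top$. An EC-derivation from a conjunction $\psi$ of xor-clauses is a sequence of xor-clauses each of which is in $\psi$ or is derived from earlier ones in the sequence by one of these rules. An extension of a derivation is a derivation that continues it with further steps. $\psi\vdash_{\mathrm{ec}}D$ means that there is an EC-derivation from $\psi$ in which $D$ occurs. **Xor-cycle.** An xor-cycle is an xor-clause conjunction of the form $(x_1\oplus x_2\oplus y_1\equiv p_1)\wedge\dots\wedge(x_{n-1}\oplus x_n\oplus y_{n-1}\equiv p_{n-1})\wedge(x_1\oplus x_n\oplus y_n\equiv p_n)$, abbreviated $\mathrm{XC}(\langle x_1,\dots,x_n\rangle,\langle y_1,\dots,y_n\rangle,p)$ where $p=p_1\oplus\dots\oplus p_n$. The variables $x_1,\dots,x_n$ are its inner variables and $y_1,\dots,y_n$ its outer variables. In the claim, the last outer variable $y_n$ is $y$, and the constants $p_1,\dots,p_n$ of the cycle are the ones appearing in the premises of $\oplus$-Imply. $\mathrm{XC}(\dots)\subseteq\phi$ means that all its xor-clauses are in $\phi$. -}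

module Defs where

open import Data.Bool using (Bool; true; false; _xor_)
open import Data.Fin using (Fin; zero; suc; fromℕ; inject₁)
open import Data.List using (List; []; _∷_; [_]; length; map; _++_)
open import Data.List.Membership.Propositional using (_∈_)
open import Data.List.Relation.Binary.Permutation.Propositional using (_↭_)
open import Data.List.Relation.Unary.All as All using (All)
import Data.List.Relation.Unary.AllPairs as AllPairs
open import Data.List.Relation.Unary.Any using (Any)
open import Data.List.Relation.Unary.Unique.Propositional using (Unique)
open import Data.Nat using (ℕ; suc)
open import Data.Product using (_×_; _,_; ∃-syntax)
open import Data.Vec.Functional using (foldr)
open import Relation.Binary.PropositionalEquality using (_≡_)
open import Relation.Nullary using (¬_)

⨁ : ∀ {m} → (Fin m → Bool) → Bool
⨁ = foldr _xor_ false

-- The order of the variables in `vars` carries no meaning: clauses are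
-- always compared with _≈_ or _is_≐_ below.
record XorClause (V : Set) : Set where
  constructor mkClause
  field
    vars   : List V
    rhs    : Bool
    normal : Unique vars

open XorClause public

private
  variable
    V : Set
    m : ℕ

infix 4 _≈_ _is_≐_ [_≐_]∈_

_≈_ : XorClause V → XorClause V → Set
C ≈ D = vars C ↭ vars D × rhs C ≡ rhs D

-- C is the xor-clause written z₁ ⊕ … ⊕ zₖ ≡ q.  As C is in normal form, this
-- forces z₁ , … , zₖ to be pairwise distinct.
_is_≐_ : XorClause V → List V → Bool → Set
C is zs ≐ q = vars C ↭ zs × rhs C ≡ q

[_≐_]∈_ : List V → Bool → List (XorClause V) → Set
[ zs ≐ q ]∈ Γ = Any (λ C → C is zs ≐ q) Γ

-- (x , true) is the literal x, (x , false) is ¬ x.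
Literal : Set → Set
Literal V = V × Bool

literalClause : Literal V → XorClause V
literalClause (x , b) = mkClause [ x ] b (All.[] AllPairs.∷ AllPairs.[])

IsVariableOf : List (XorClause V) → V → Set
IsVariableOf φ x = Any (λ C → x ∈ vars C) φ

_∧-literals_ : List (XorClause V) → List (Literal V) → List (XorClause V)
φ ∧-literals ls = φ ++ map literalClause ls

ShareAtMostOne : XorClause V → XorClause V → Set
ShareAtMostOne C D =
  ∀ {u v} → u ∈ vars C → u ∈ vars D → v ∈ vars C → v ∈ vars D → u ≡ v

-- A conjunction is regarded as a set of clauses, so a "pair" consists of
-- clauses that differ modulo _≈_.
record 3-XorNormalForm {V : Set} (φ : List (XorClause V)) : Set where
  field
    ternary : All (λ C → length (vars C) ≡ 3) φ
    sharing : ∀ {C D} → C ∈ φ → D ∈ φ → ¬ (C ≈ D) → ShareAtMostOne C D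

-- In the chains and cycles below the number of inner variables is n = suc m,
-- with x₁ = x zero and xₙ = x (fromℕ m).  The degenerate case n = 1 never
-- arises, because a closing clause mentions both x₁ and xₙ and is in normal form.

Chain : List (XorClause V) → (Fin (suc m) → V) → (Fin m → Bool) → Set
Chain Γ x c = ∀ i → [ x (inject₁ i) ∷ x (suc i) ∷ [] ≐ c i ]∈ Γ

-- C follows from x₁⊕x₂≡c₁ , … , xₙ₋₁⊕xₙ≡cₙ₋₁ and x₁⊕xₙ⊕y≡d, all in Γ, by ⊕-Imply.
record Imply {V : Set} {m : ℕ} (Γ : List (XorClause V))
             (x : Fin (suc m) → V) (y : V) (c : Fin m → Bool) (d : Bool)
             (C : XorClause V) : Set where
  constructor mkImply
  field
    chain      : Chain Γ x c
    closing    : [ x zero ∷ x (fromℕ m) ∷ y ∷ [] ≐ d ]∈ Γ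
    conclusion : C is [ y ] ≐ (⨁ c xor d)

-- One derivation step producing C, where Γ lists the earlier clauses.
-- The clause ⊥ is the empty clause with right-hand side ⊤.
data Step {V : Set} (ψ Γ : List (XorClause V)) (C : XorClause V) : Set where
  given : Any (C ≈_) ψ → Step ψ Γ C
  conflict : ∀ {x} →
    [ x ∷ [] ≐ true ]∈ Γ → [ x ∷ [] ≐ false ]∈ Γ →
    C is [] ≐ true → Step ψ Γ C
  ⊕-unit² : ∀ {x y a b} →
    [ x ∷ [] ≐ a ]∈ Γ → [ x ∷ y ∷ [] ≐ b ]∈ Γ →
    C is y ∷ [] ≐ (a xor b) → Step ψ Γ C
  ⊕-unit³ : ∀ {x y z a b} →
    [ x ∷ [] ≐ a ]∈ Γ → [ x ∷ y ∷ z ∷ [] ≐ b ]∈ Γ →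
    C is y ∷ z ∷ [] ≐ (a xor b) → Step ψ Γ C
  ⊕-imply : ∀ {m} {x : Fin (suc m) → V} {y c d} →
    Imply Γ x y c d C → Step ψ Γ C
  ⊕-conflict : ∀ {m} {x : Fin (suc m) → V} {c cₙ} →
    Chain Γ x c → [ x (fromℕ m) ∷ x zero ∷ [] ≐ cₙ ]∈ Γ →
    ⨁ c xor cₙ ≡ true →
    C is [] ≐ true → Step ψ Γ C

-- Derivation ψ Γ: an EC-derivation from ψ whose sequence of clauses is Γ,
-- most recent clause first.
infixl 5 _▷_
data Derivation {V : Set} (ψ : List (XorClause V)) : List (XorClause V) → Set where
  []  : Derivation ψ []
  _▷_ : ∀ {Γ C} → Derivation ψ Γ → Step ψ Γ C → Derivation ψ (C ∷ Γ)

infix 4 _⊢ec_≐_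
_⊢ec_≐_ : List (XorClause V) → List V → Bool → Set
ψ ⊢ec zs ≐ q = ∃[ Γ ] (Derivation ψ Γ × [ zs ≐ q ]∈ Γ)

infix 4 _⊑_
data _⊑_ {V : Set} {ψ Γ : List (XorClause V)} (π : Derivation ψ Γ) :
         ∀ {Γ′} → Derivation ψ Γ′ → Set where
  done   : π ⊑ π
  extend : ∀ {Γ′ C} {π′ : Derivation ψ Γ′} {s : Step ψ Γ′ C} → π ⊑ π′ → π ⊑ (π′ ▷ s)

-- Some step of the derivation derives y≡r by ⊕-Imply from x₁⊕x₂≡c₁ , … ,
-- xₙ₋₁⊕xₙ≡cₙ₋₁ and x₁⊕xₙ⊕y≡d.
data UsesImply {V : Set} {m : ℕ} {ψ : List (XorClause V)}
               (x : Fin (suc m) → V) (y : V) (c : Fin m → Bool) (d r : Bool) :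
               ∀ {Γ} → Derivation ψ Γ → Set where
  here  : ∀ {Γ C} {π : Derivation ψ Γ} (inst : Imply Γ x y c d C) →
          C is [ y ] ≐ r → UsesImply x y c d r (π ▷ ⊕-imply inst)
  there : ∀ {Γ C} {π : Derivation ψ Γ} {s : Step ψ Γ C} →
          UsesImply x y c d r π → UsesImply x y c d r (π ▷ s)

-- XC(⟨x₁,…,xₙ⟩,⟨y₁,…,yₙ⟩,p) ⊆ φ with clause constants p₁,…,pₙ, p = ⨁ ps.
record XC⊆ {V : Set} {m : ℕ} (φ : List (XorClause V))
           (x ys : Fin (suc m) → V) (ps : Fin (suc m) → Bool) (p : Bool) : Set where
  field
    path   : ∀ (i : Fin m) →
             [ x (inject₁ i) ∷ x (suc i) ∷ ys (inject₁ i) ∷ [] ≐ ps (inject₁ i) ]∈ φ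
    close  : [ x zero ∷ x (fromℕ m) ∷ ys (fromℕ m) ∷ [] ≐ ps (fromℕ m) ]∈ φ
    parity : p ≡ ⨁ ps

{-# OPTIONS --safe #-}

-- In an EC-derivation from ternary clauses and literals, a ternary clause can
-- only be a given clause of φ, and a binary clause can only arise by ⊕-Unit³,
-- i.e. from a clause of φ and a derived literal on its third variable.  So the
-- premises of an ⊕-Imply step are exactly an xor-cycle in φ together with
-- derivations of its outer literals y₁ , … , yₙ₋₁.
module Submission where

open import Algebra.Bundles using (CommutativeRing)
open import Data.Bool using (Bool; _xor_)
open import Data.Bool.Properties using (xor-assoc; xor-comm; xor-∧-commutativeRing)
open import Data.Fin using (Fin; zero; suc; fromℕ; inject₁)
open import Data.List using (List; []; _∷_; [_]; length; _++_)
open import Data.List.Relation.Binary.Permutation.Propositional using (_↭_; ↭-refl; ↭-sym; ↭-trans; ↭-prep; ↭⇒↭ₛ)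
open import Data.List.Relation.Binary.Permutation.Propositional.Properties using (shift; ↭-length)
import Data.List.Relation.Binary.Permutation.Setoid.Properties as ↭ₛ
open import Data.List.Relation.Binary.Subset.Propositional using (_⊆_)
open import Data.List.Relation.Binary.Subset.Propositional.Properties using (Any-resp-⊆; xs⊆xs++ys)
open import Data.List.Relation.Unary.All as All using (All; []; _∷_)
open import Data.List.Relation.Unary.AllPairs using ([]; _∷_)
open import Data.List.Relation.Unary.Any as Any using (Any; here; there)
open import Data.List.Relation.Unary.Any.Properties using (++⁺ˡ; ++⁻; map⁻)
open import Data.List.Relation.Unary.Unique.Propositional using (Unique)
open import Data.Nat using (ℕ; zero; suc)
open import Data.Product using (_×_; _,_; proj₁; ∃-syntax; Σ-syntax)
open import Data.Sum using (inj₁; inj₂)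
open import Function using (_∘_)
open import Function.Bundles using (_⇔_; mk⇔)
open import Relation.Binary.PropositionalEquality using (_≡_; _≢_; refl; sym; trans; cong; subst; subst₂; setoid; module ≡-Reasoning)
open import Relation.Nullary using (contradiction)
open import Defs

open import Algebra.Properties.CommutativeMonoid.Sum
  (CommutativeRing.+-commutativeMonoid xor-∧-commutativeRing)
  using (sum-cong-≗; sum-init-last; ∑-distrib-+)

private
  variable
    A V : Set
    ψ Γ Δ : List (XorClause V)
    C : XorClause V
    zs zs′ : List V
    m : ℕ
    q : Bool

infixl 5 _∷ʳ_

-- The new entry sits at `fromℕ m` and the old ones at `inject₁ i`, which is how `XC⊆` separates the
-- closing clause from the path.
_∷ʳ_ : (Fin m → A) → A → Fin (suc m) → A
_∷ʳ_ {zero}  f a _       = a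
_∷ʳ_ {suc m} f a zero    = f zero
_∷ʳ_ {suc m} f a (suc i) = (f ∘ suc ∷ʳ a) i

∷ʳ-inject₁ : ∀ (f : Fin m → A) a i → (f ∷ʳ a) (inject₁ i) ≡ f i
∷ʳ-inject₁ f a zero    = refl
∷ʳ-inject₁ f a (suc i) = ∷ʳ-inject₁ (f ∘ suc) a i

∷ʳ-fromℕ : ∀ (f : Fin m → A) a → (f ∷ʳ a) (fromℕ m) ≡ a
∷ʳ-fromℕ {zero}  f a = refl
∷ʳ-fromℕ {suc m} f a = ∷ʳ-fromℕ (f ∘ suc) a

-- Reconciles the constant concluded by ⊕-Imply with the one in the theorem. Since `⨁` is
-- definitionally the `sum` of the xor monoid, the sum laws split `c` into its two summands, and
-- `pₙ` then rejoins the initial part of `ps`.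
⨁-cycle : ∀ {c : Fin m → Bool} (ps : Fin (suc m) → Bool) (p′ : Fin m → Bool) →
          (∀ i → c i ≡ ps (inject₁ i) xor p′ i) →
          ⨁ c xor ps (fromℕ m) ≡ ⨁ ps xor ⨁ p′
⨁-cycle {m} {c} ps p′ c≡ = begin
  ⨁ c xor pₙ                          ≡⟨ cong (_xor pₙ) (sum-cong-≗ c≡) ⟩
  ⨁ (λ i → init-ps i xor p′ i) xor pₙ ≡⟨ cong (_xor pₙ) (∑-distrib-+ init-ps p′) ⟩
  (⨁ init-ps xor ⨁ p′) xor pₙ         ≡⟨ xor-assoc (⨁ init-ps) (⨁ p′) pₙ ⟩
  ⨁ init-ps xor (⨁ p′ xor pₙ)         ≡⟨ cong (⨁ init-ps xor_) (xor-comm (⨁ p′) pₙ) ⟩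
  ⨁ init-ps xor (pₙ xor ⨁ p′)         ≡⟨ xor-assoc (⨁ init-ps) pₙ (⨁ p′) ⟨
  (⨁ init-ps xor pₙ) xor ⨁ p′         ≡⟨ cong (_xor ⨁ p′) (sum-init-last ps) ⟨
  ⨁ ps xor ⨁ p′                       ∎
  where
  open ≡-Reasoning
  pₙ : Bool
  pₙ = ps (fromℕ m)
  init-ps : Fin m → Bool
  init-ps = ps ∘ inject₁

Unique-resp-↭ : zs ↭ zs′ → Unique zs → Unique zs′
Unique-resp-↭ p = ↭ₛ.Unique-resp-↭ (setoid _) (↭⇒↭ₛ p)

∈⇒Unique : [ zs ≐ q ]∈ Γ → Unique zs
∈⇒Unique h with C , vars↭ , _ ← Any.satisfied h = Unique-resp-↭ vars↭ (normal C)

[≐]∈-resp-↭ : zs ↭ zs′ → [ zs ≐ q ]∈ Γ → [ zs′ ≐ q ]∈ Γ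
[≐]∈-resp-↭ p = Any.map λ (vars↭ , rhs≡) → ↭-trans vars↭ p , rhs≡

given⇒∈ : ∀ C → C is zs ≐ q → Any (C ≈_) ψ → [ zs ≐ q ]∈ ψ
given⇒∈ _ (C↭zs , C≡q) =
  Any.map λ (C↭D , C≡D) → ↭-trans (↭-sym C↭D) C↭zs , trans (sym C≡D) C≡q

is-length : ∀ (C : XorClause V) {zs zs′ q q′} →
            C is zs ≐ q → C is zs′ ≐ q′ → length zs ≡ length zs′
is-length _ (p , _) (p′ , _) = trans (sym (↭-length p)) (↭-length p′)

Step-mono : Γ ⊆ Δ → Step ψ Γ C → Step ψ Δ C
Step-mono s (given h)            = given h
Step-mono s (conflict h h′ e)    = conflict (Any-resp-⊆ s h) (Any-resp-⊆ s h′) e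
Step-mono s (⊕-unit² h h′ e)     = ⊕-unit² (Any-resp-⊆ s h) (Any-resp-⊆ s h′) e
Step-mono s (⊕-unit³ h h′ e)     = ⊕-unit³ (Any-resp-⊆ s h) (Any-resp-⊆ s h′) e
Step-mono s (⊕-imply {x = x} (mkImply ch cl e)) =
  ⊕-imply {x = x} (mkImply (Any-resp-⊆ s ∘ ch) (Any-resp-⊆ s cl) e)
Step-mono s (⊕-conflict {x = x} ch h p e) =
  ⊕-conflict {x = x} (Any-resp-⊆ s ∘ ch) (Any-resp-⊆ s h) p e

-- The second derivation is replayed after `π`: a step only looks its premises up among the earlier
-- clauses, so additional ones do no harm.
append : (π : Derivation ψ Γ) → Derivation ψ Δ →
         Σ[ π′ ∈ Derivation ψ (Δ ++ Γ) ] π ⊑ π′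
append π [] = π , done
append {Γ = Γ} π (_▷_ {Γ = Δ} ρ s) with append π ρ
... | π′ , π⊑π′ = π′ ▷ Step-mono (xs⊆xs++ys Δ Γ) s , extend π⊑π′

⊑-trans : ∀ {Γ₁ Γ₂ Γ₃} {π₁ : Derivation ψ Γ₁} {π₂ : Derivation ψ Γ₂} {π₃ : Derivation ψ Γ₃} →
          π₁ ⊑ π₂ → π₂ ⊑ π₃ → π₁ ⊑ π₃
⊑-trans p done       = p
⊑-trans p (extend q) = extend (⊑-trans p q)

⊑⇒⊆ : {π : Derivation ψ Γ} {π′ : Derivation ψ Δ} → π ⊑ π′ → Γ ⊆ Δ
⊑⇒⊆ done       h = h
⊑⇒⊆ (extend p) h = there (⊑⇒⊆ p h)

extend-by : (π : Derivation ψ Γ) → ψ ⊢ec zs ≐ q →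
            ∃[ Γ′ ] Σ[ π′ ∈ Derivation ψ Γ′ ] (π ⊑ π′ × [ zs ≐ q ]∈ Γ′)
extend-by {Γ = Γ} π (Δ , ρ , h) with append π ρ
... | π′ , π⊑π′ = Δ ++ Γ , π′ , π⊑π′ , Any-resp-⊆ (xs⊆xs++ys Δ Γ) h

-- The derivations are stacked one after another; a clause obtained early stays available because an
-- extension only adds clauses.
extend-by-all : ∀ {zs : Fin m → List V} {q : Fin m → Bool} {ψ Γ}
                (π : Derivation ψ Γ) → (∀ i → ψ ⊢ec zs i ≐ q i) →
                ∃[ Γ′ ] Σ[ π′ ∈ Derivation ψ Γ′ ] (π ⊑ π′ × ∀ i → [ zs i ≐ q i ]∈ Γ′)
extend-by-all {zero}  π _ = _ , π , done , λ ()
extend-by-all {suc m} π d with extend-by π (d zero)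
... | _ , π₁ , π⊑π₁ , h with extend-by-all π₁ (d ∘ suc)
... | _ , π₂ , π₁⊑π₂ , hs =
  _ , π₂ , ⊑-trans π⊑π₁ π₁⊑π₂ ,
  λ { zero → Any-resp-⊆ (⊑⇒⊆ π₁⊑π₂) h ; (suc i) → hs i }

⊢ec-given : [ zs ≐ q ]∈ ψ → ψ ⊢ec zs ≐ q
⊢ec-given {zs = zs} {q} h =
  [ mkClause zs q (∈⇒Unique h) ] ,
  [] ▷ given (Any.map (λ (p , e) → ↭-sym p , sym e) h) ,
  here (↭-refl , refl)

⊢ec-unit³ : ∀ {ψ} {u v w : V} {a b} → [ u ∷ v ∷ w ∷ [] ≐ b ]∈ ψ →
            ψ ⊢ec [ w ] ≐ a → ψ ⊢ec u ∷ v ∷ [] ≐ (b xor a)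
⊢ec-unit³ {u = u} {v} {w} {a} {b} h (Γ , ρ , h′)
  -- ⊕-Unit³ eliminates the variable listed first, so `w` is rotated to the front; normality of the
  -- rotated clause yields that of the conclusion.
  with wuv ← [≐]∈-resp-↭ (shift w (u ∷ v ∷ []) []) h
  with _ ∷ unique-uv ← ∈⇒Unique wuv
  with _ , ρ′ , ρ⊑ρ′ , k ← extend-by ρ (⊢ec-given wuv)
  = mkClause (u ∷ v ∷ []) (b xor a) unique-uv ∷ _ ,
    ρ′ ▷ ⊕-unit³ (Any-resp-⊆ (⊑⇒⊆ ρ⊑ρ′) h′) k (↭-refl , xor-comm b a) ,
    here (↭-refl , refl)

-- The derivation preceding the step is returned too, so that the premises of the step can be traced
-- back in turn.
∈⇒Step : Derivation ψ Γ → [ zs ≐ q ]∈ Γ →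
         ∃[ Γ₀ ] ∃[ C ] (Derivation ψ Γ₀ × Step ψ Γ₀ C × C is zs ≐ q)
∈⇒Step (π ▷ s) (here e)  = _ , _ , π , s , e
∈⇒Step (π ▷ s) (there h) = ∈⇒Step π h

UsesImply⇒Imply : ∀ {x : Fin (suc m) → V} {y c d r ψ Γ} {π : Derivation ψ Γ} →
  UsesImply x y c d r π →
  ∃[ Γ₀ ] ∃[ C ] (Derivation ψ Γ₀ × Imply Γ₀ x y c d C × C is [ y ] ≐ r)
UsesImply⇒Imply (here {π = π} inst e) = _ , _ , π , inst , e
UsesImply⇒Imply (there u)             = UsesImply⇒Imply u

-- The raw material of one path clause of the cycle: `third`, `const` and `value` become yᵢ, pᵢ and
-- pᵢ′.
record Unit³Source {V : Set} (φ ψ : List (XorClause V)) (u v : V) (c : Bool) : Set where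
  field
    third       : V
    const value : Bool
    clause      : [ u ∷ v ∷ third ∷ [] ≐ const ]∈ φ
    literal     : ψ ⊢ec [ third ] ≐ value
    sum≡        : c ≡ const xor value

module _ {V : Set} {φ : List (XorClause V)} {ls : List (Literal V)}
         (ternary : All (λ C → length (vars C) ≡ 3) φ) where

  ∈-φ-length : ∀ {zs q} → [ zs ≐ q ]∈ φ → length zs ≡ 3
  ∈-φ-length h with All.lookupAny ternary h
  ... | len , vars↭ , _ = trans (sym (↭-length vars↭)) len

  -- The clauses adjoined to `φ` are literals, each with exactly one variable.
  nonunit-∈⇒∈-φ : ∀ {zs q} → length zs ≢ 1 → [ zs ≐ q ]∈ (φ ∧-literals ls) → [ zs ≐ q ]∈ φ
  nonunit-∈⇒∈-φ len≢1 h with ++⁻ φ h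
  ... | inj₁ h∈φ = h∈φ
  ... | inj₂ h∈ls with _ , vars↭ , _ ← Any.satisfied (map⁻ h∈ls) =
    contradiction (sym (↭-length vars↭)) len≢1

  -- Every inference rule concludes a clause with at most two variables, so counting variables
  -- leaves only `given`.
  ternary-source : ∀ {Γ u v w q} → Derivation (φ ∧-literals ls) Γ →
                   [ u ∷ v ∷ w ∷ [] ≐ q ]∈ Γ → [ u ∷ v ∷ w ∷ [] ≐ q ]∈ φ
  ternary-source π h with ∈⇒Step π h
  ... | _ , C , _ , given g , e = nonunit-∈⇒∈-φ (λ ()) (given⇒∈ C e g)
  ... | _ , C , _ , conflict _ _ e′ , e = contradiction (is-length C e′ e) λ ()
  ... | _ , C , _ , ⊕-unit² _ _ e′ , e = contradiction (is-length C e′ e) λ ()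
  ... | _ , C , _ , ⊕-unit³ _ _ e′ , e = contradiction (is-length C e′ e) λ ()
  ... | _ , C , _ , ⊕-imply i , e = contradiction (is-length C (Imply.conclusion i) e) λ ()
  ... | _ , C , _ , ⊕-conflict _ _ _ e′ , e = contradiction (is-length C e′ e) λ ()

  -- Given clauses have three variables or one, and among the rules only ⊕-Unit³ concludes a clause
  -- with two.
  binary-source : ∀ {Γ u v c} → Derivation (φ ∧-literals ls) Γ → [ u ∷ v ∷ [] ≐ c ]∈ Γ →
    Unit³Source φ (φ ∧-literals ls) u v c
  binary-source {u = u} {v} π h with ∈⇒Step π h
  ... | _ , C , _ , given g , e =
    contradiction (∈-φ-length (nonunit-∈⇒∈-φ (λ ()) (given⇒∈ C e g))) λ ()
  ... | _ , C , _ , conflict _ _ e′ , e = contradiction (is-length C e′ e) λ ()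
  ... | _ , C , _ , ⊕-unit² _ _ e′ , e = contradiction (is-length C e′ e) λ ()
  ... | _ , _ , π₀ , ⊕-unit³ {x = w} {a = a} {b} h₁ h₃ (C↭yz , C≡ab) , (C↭uv , C≡c) =
    record
      { third   = w
      ; const   = b
      ; value   = a
      ; clause  = [≐]∈-resp-↭ (↭-trans (↭-prep w (↭-trans (↭-sym C↭yz) C↭uv))
                                       -- The two listings of the variables of the derived clause
                                       -- turn the premise into `w`, `u`, `v`; `shift` then moves
                                       -- `w` to the last place.
                                       (↭-sym (shift w (u ∷ v ∷ []) [])))
                              (ternary-source π₀ h₃)
      ; literal = _ , π₀ , h₁
      ; sum≡    = trans (sym C≡c) (trans C≡ab (xor-comm a b))
      }
  ... | _ , C , _ , ⊕-imply i , e = contradiction (is-length C (Imply.conclusion i) e) λ ()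
  ... | _ , C , _ , ⊕-conflict _ _ _ e′ , e = contradiction (is-length C e′ e) λ ()

lemma1 : {V : Set} (φ : List (XorClause V)) (ls : List (Literal V)) →
    3-XorNormalForm φ →
    All (λ l → IsVariableOf φ (proj₁ l)) ls →
    ∀ {Γ} (π : Derivation (φ ∧-literals ls) Γ) →
    ∀ (m : ℕ) (x : Fin (suc m) → V) (y : V) (c : Fin m → Bool) (pₙ r : Bool) →
    (∃[ Γ′ ] Σ[ π′ ∈ Derivation (φ ∧-literals ls) Γ′ ]
    (π ⊑ π′ × UsesImply x y c pₙ r π′))
    ⇔
    (Σ[ ys ∈ (Fin (suc m) → V) ] Σ[ ps ∈ (Fin (suc m) → Bool) ]
    Σ[ p′ ∈ (Fin m → Bool) ] Σ[ p ∈ Bool ]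
    ( (∀ i → c i ≡ ps (inject₁ i) xor p′ i)
    × pₙ ≡ ps (fromℕ m)
    × r ≡ p xor ⨁ p′
    × y ≡ ys (fromℕ m)
    × XC⊆ φ x ys ps p
    × (∀ i → φ ∧-literals ls ⊢ec [ ys (inject₁ i) ] ≐ p′ i)))
lemma1 {V} φ ls nf _ π m x y c pₙ r = mk⇔ imply⇒cycle cycle⇒imply
  where
  open 3-XorNormalForm nf using (ternary)

  imply⇒cycle : _ → _
  imply⇒cycle (_ , _ , _ , uses)
    with _ , _ , π₀ , mkImply chain closing (_ , C≡⨁c) , (_ , C≡r) ← UsesImply⇒Imply uses
    -- The path entries come from the sources of the chain premises; `y` and `pₙ` of the closing
    -- premise fill the last position.
    = ys , ps , p′ , ⨁ ps , c≡ , pₙ≡ ,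
      -- Two readings of the right-hand side of the same derived clause are compared: `r`, and the
      -- constant given by ⊕-Imply.
      trans (sym C≡r) (trans C≡⨁c (trans (cong (⨁ c xor_) pₙ≡) (⨁-cycle ps p′ c≡))) ,
      y≡ ,
      record
        { path   = λ i → subst₂ (λ w q → [ x (inject₁ i) ∷ x (suc i) ∷ w ∷ [] ≐ q ]∈ φ)
                           (sym (∷ʳ-inject₁ outer y i)) (sym (∷ʳ-inject₁ b pₙ i))
                           (clause (source i))
        ; close  = subst₂ (λ w q → [ x zero ∷ x (fromℕ m) ∷ w ∷ [] ≐ q ]∈ φ) y≡ pₙ≡
                     (ternary-source {ls = ls} ternary π₀ closing)
        ; parity = refl
        } ,
      λ i → subst (λ w → φ ∧-literals ls ⊢ec [ w ] ≐ p′ i) (sym (∷ʳ-inject₁ outer y i))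
              (literal (source i))
    where
    open Unit³Source
    source : ∀ i → Unit³Source φ (φ ∧-literals ls) (x (inject₁ i)) (x (suc i)) (c i)
    source i = binary-source {ls = ls} ternary π₀ (chain i)
    outer : Fin m → V
    outer i = third (source i)
    b p′ : Fin m → Bool
    b i = const (source i)
    p′ i = value (source i)
    ys : Fin (suc m) → V
    ys = outer ∷ʳ y
    ps : Fin (suc m) → Bool
    ps = b ∷ʳ pₙ
    y≡ : y ≡ ys (fromℕ m)
    y≡ = sym (∷ʳ-fromℕ outer y)
    pₙ≡ : pₙ ≡ ps (fromℕ m)
    pₙ≡ = sym (∷ʳ-fromℕ b pₙ)
    c≡ : ∀ i → c i ≡ ps (inject₁ i) xor p′ i
    c≡ i = trans (sum≡ (source i))
                 (cong (_xor p′ i) (sym (∷ʳ-inject₁ b pₙ i)))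

  cycle⇒imply : _ → _
  cycle⇒imply (ys , ps , p′ , p , c≡ , refl , refl , refl , cycle , outer)
    -- Each chain premise is derived by ⊕-Unit³ from a path clause and its outer literal. The
    -- equations on `c` hold only pointwise, hence the transport along `c≡ i`.
    with _ , π₁ , π⊑π₁ , chain ← extend-by-all π (λ i →
           subst (φ ∧-literals ls ⊢ec x (inject₁ i) ∷ x (suc i) ∷ [] ≐_) (sym (c≡ i))
             (⊢ec-unit³ (++⁺ˡ (XC⊆.path cycle i)) (outer i)))
    with _ , π₂ , π₁⊑π₂ , closing ← extend-by π₁ (⊢ec-given (++⁺ˡ (XC⊆.close cycle)))
    = _ ,
      -- Here `r` has become `p xor ⨁ p′`, so the parity of the cycle and `⨁-cycle` read backwards
      -- give the constant that ⊕-Imply requires.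
      π₂ ▷ ⊕-imply (mkImply {C = literalClause (y , r)}
                     (Any-resp-⊆ (⊑⇒⊆ π₁⊑π₂) ∘ chain) closing
                     (↭-refl , trans (cong (_xor ⨁ p′) (XC⊆.parity cycle)) (sym (⨁-cycle ps p′ c≡)))) ,
      extend (⊑-trans π⊑π₁ π₁⊑π₂) ,
      here _ (↭-refl , refl)
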